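{- Let $k\ge2$, $m\ge0$, $1\le s\le k$, and $N=mk+s$. Then $$|\mathcal{D}_{N,k}(321)|=\sum_{a=0}^{\lfloor N/2\rfloor}K_{N,k}(a)\,\frac{N-2a+1}{N-a+1}\binom{N}{a}.$$
   Context: For $\pi=\pi_1\cdots\pi_N\in S_N$ let $\operatorname{Des}(\pi)=\{i\in[N-1]:\pi_i>\pi_{i+1}\}$. For $k\ge2$, $N\ge1$, let $\mathcal{D}_{N,k}=\{\pi\in S_N:\operatorname{Des}(\pi)=\{k,2k,\ldots,k\lfloor (N-1)/k\rfloor\}\}$. $\mathcal{D}_{N,k}(321)$ is the set of elements of $\mathcal{D}_{N,k}$ having no decreasing subsequence of length three. A ballot word of length $N$ is a word $w_1\cdots w_N$ in the letters $U,D$ such that every prefix contains at least as many $U$'s as $D$'s. It has a peak $UD$ at position $i$ if $w_i=U$ and $w_{i+1}=D$. $K_{N,k}(a)$ is the number of ballot words of length $N=mk+s$ with exactly $a$ letters $D$ such that the set of positions of its peaks $UD$ is exactly $\{k,2k,\ldots,km\}$. -}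

module Defs where

open import Data.Nat using (ℕ; zero; suc; _+_; _*_; _∸_; _/_; _≤_; _≤?_; NonZero; NonTrivial)
open import Data.Nat.Base using (nonTrivial⇒nonZero)
open import Data.Nat.Combinatorics using (_C_)
import Data.Nat.Properties as ℕ
import Data.Integer as ℤ
import Data.Rational as ℚ
open ℚ using (ℚ; 0ℚ)
open import Data.Fin using (Fin; toℕ; _<_; _>_)
open import Data.Fin.Properties using (_≟_; _<?_; any?; all?)
open import Data.List using (List; []; _∷_; cartesianProductWith; filter; length; inits; allFin; map; foldr; upTo)
open import Data.List.Membership.Propositional using (_∈_)
open import Data.List.Membership.Propositional.Properties using (∈-cartesianProductWith⁺)
open import Data.List.Relation.Unary.All as All using (All)
import Data.List.Relation.Unary.All.Properties as All
open import Data.List.Relation.Unary.Any using (here)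
import Data.List.Relation.Unary.AllPairs as AllPairs
import Data.List.Relation.Unary.Unique.Propositional as List
open import Data.List.Relation.Unary.Unique.Propositional.Properties using (cartesianProductWith⁺)
open import Data.Product using (∃; _×_; _,_)
open import Data.Vec using (Vec; []; _∷_; lookup; toList)
open import Data.Vec.Properties using (∷-injective)
open import Data.Vec.Relation.Unary.Unique.Propositional using (Unique)
open import Data.Vec.Relation.Unary.AllPairs using (allPairs?)
open import Level using (Level; 0ℓ)
open import Relation.Binary using (Rel; DecidableEquality) renaming (Decidable to Decidable₂)
open import Relation.Binary.PropositionalEquality using (_≡_; refl)
open import Relation.Nullary using (¬_; Dec; yes; no; ¬?; _×-dec_; _→-dec_)
open import Relation.Nullary.Decidable using (map′)
open import Relation.Unary using (Pred; Decidable; _≐_)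

private
  variable
    ℓ : Level
    A : Set
    n N : ℕ

words : List A → ∀ n → List (Vec A n)
words xs zero    = [] ∷ []
words xs (suc n) = cartesianProductWith _∷_ xs (words xs n)

-- If xs lists every element of A exactly once, then words xs n lists every
-- word exactly once, so that countWords below is a cardinality.
words-complete : {xs : List A} → (∀ a → a ∈ xs) → (w : Vec A n) → w ∈ words xs n
words-complete all∈ []      = here refl
words-complete all∈ (a ∷ w) = ∈-cartesianProductWith⁺ _∷_ (all∈ a) (words-complete all∈ w)

words-unique : {xs : List A} → List.Unique xs → ∀ n → List.Unique (words xs n)
words-unique u zero    = All.[] AllPairs.∷ AllPairs.[]
words-unique u (suc n) = cartesianProductWith⁺ _∷_ ∷-injective u (words-unique u n)

countWords : List A → ∀ n {P : Pred (Vec A n) ℓ} → Decidable P → ℕ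
countWords xs n P? = length (filter P? (words xs n))

-- Positions in a word are numbered from 1: the letter w_p of w is lookup w i
-- for the i : Fin N with suc (toℕ i) ≡ p.

-- The set of positions p ∈ [N-1] such that R w_p w_{p+1}.
AdjacentAt : Rel A 0ℓ → Vec A N → Pred ℕ 0ℓ
AdjacentAt R w p = ∃ λ i → ∃ λ j →
  p ≡ suc (toℕ i) × toℕ j ≡ suc (toℕ i) × R (lookup w i) (lookup w j)

-- {k, 2k, …, kq}
Multiples : (k q : ℕ) → Pred ℕ 0ℓ
Multiples k q p = ∃ λ (j : Fin q) → p ≡ k * suc (toℕ j)

adjacentAt? : {R : Rel A 0ℓ} → Decidable₂ R → (w : Vec A N) → Decidable (AdjacentAt R w)
adjacentAt? R? w p = any? λ i → any? λ j →
  (p ℕ.≟ suc (toℕ i)) ×-dec (toℕ j ℕ.≟ suc (toℕ i)) ×-dec R? (lookup w i) (lookup w j)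

multiples? : ∀ k q → Decidable (Multiples k q)
multiples? k q p = any? λ j → p ℕ.≟ k * suc (toℕ j)

adjacent≐multiples? : {R : Rel A 0ℓ} → Decidable₂ R →
  ∀ k q (w : Vec A N) → Dec (AdjacentAt R w ≐ Multiples k q)
adjacent≐multiples? R? k q w =
  map′ (λ f → λ { (i , j , refl , e , r) → f i j e r })
       (λ f i j e r → f (i , j , refl , e , r))
       (all? λ i → all? λ j → (toℕ j ℕ.≟ suc (toℕ i)) →-dec
          (R? (lookup w i) (lookup w j) →-dec multiples? k q (suc (toℕ i))))
  ×-dec
  map′ (λ f → λ { (j , refl) → f j }) (λ f j → f (j , refl))
       (all? λ j → adjacentAt? R? w (k * suc (toℕ j)))

-- Permutations are in one-line notation, as words of length N with distinct
-- letters over the N-letter alphabet Fin N.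

Des : Vec (Fin N) N → Pred ℕ 0ℓ
Des = AdjacentAt _>_

Has321 : Vec (Fin N) N → Set
Has321 π = ∃ λ i → ∃ λ j → ∃ λ l →
  i < j × j < l × lookup π i > lookup π j × lookup π j > lookup π l

has321? : Decidable (Has321 {N})
has321? π = any? λ i → any? λ j → any? λ l →
  (i <? j) ×-dec (j <? l) ×-dec
  (lookup π j <? lookup π i) ×-dec (lookup π l <? lookup π j)

module _ (N k : ℕ) .{{_ : NonTrivial k}} where
  private
    instance
      k≢0 : NonZero k
      k≢0 = nonTrivial⇒nonZero k

  𝒟 : Pred (Vec (Fin N) N) 0ℓ
  𝒟 π = Unique π × Des π ≐ Multiples k ((N ∸ 1) / k)

  𝒟? : Decidable 𝒟
  𝒟? π = allPairs? (λ x y → ¬? (x ≟ y)) π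
         ×-dec adjacent≐multiples? (λ x y → y <? x) k ((N ∸ 1) / k) π

  𝒟321 : Pred (Vec (Fin N) N) 0ℓ
  𝒟321 π = 𝒟 π × ¬ Has321 π

  𝒟321? : Decidable 𝒟321
  𝒟321? π = 𝒟? π ×-dec ¬? (has321? π)

  ∣𝒟321∣ : ℕ
  ∣𝒟321∣ = countWords (allFin N) N 𝒟321?

data Letter : Set where
  U D : Letter

_≟ᴸ_ : DecidableEquality Letter
U ≟ᴸ U = yes refl
U ≟ᴸ D = no λ ()
D ≟ᴸ U = no λ ()
D ≟ᴸ D = yes refl

occurrences : Letter → List Letter → ℕ
occurrences x w = length (filter (x ≟ᴸ_) w)

Ballot : Vec Letter N → Set
Ballot w = All (λ u → occurrences D u ≤ occurrences U u) (inits (toList w))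

IsUD : Rel Letter 0ℓ
IsUD x y = x ≡ U × y ≡ D

Peaks : Vec Letter N → Pred ℕ 0ℓ
Peaks = AdjacentAt IsUD

module _ (k m s a : ℕ) where

  KWord : Pred (Vec Letter (m * k + s)) 0ℓ
  KWord w = Ballot w × occurrences D (toList w) ≡ a × Peaks w ≐ Multiples k m

  KWord? : Decidable KWord
  KWord? w = All.all? (λ u → occurrences D u ≤? occurrences U u) (inits (toList w))
             ×-dec (occurrences D (toList w) ℕ.≟ a)
             ×-dec adjacent≐multiples? (λ x y → (x ≟ᴸ U) ×-dec (y ≟ᴸ D)) k m w

  -- K_{N,k}(a) for N = mk + s.
  K : ℕ
  K = countWords (U ∷ D ∷ []) (m * k + s) KWord?

fromℕ : ℕ → ℚ
fromℕ n = ℤ.+ n ℚ./ 1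

-- (N - 2a + 1)/(N - a + 1) · binom(N, a); the truncated subtractions are
-- exact for a ≤ ⌊N/2⌋.
ballotNumber : (N a : ℕ) → ℚ
ballotNumber N a = (ℤ.+ (N ∸ 2 * a + 1) ℚ./ suc (N ∸ a)) ℚ.* fromℕ (N C a)

-- f 0 + f 1 + ⋯ + f n
sum[0…_] : ℕ → (ℕ → ℚ) → ℚ
sum[0… n ] f = foldr ℚ._+_ 0ℚ (map f (upTo (suc n)))

{-# OPTIONS --safe #-}

-- Robinson–Schensted restricted to two rows. A standard tableau with at most
-- two rows is a ballot word (U for an entry of the first row, D for one of the
-- second), and i is a descent of the recording tableau exactly when its word
-- has a peak UD at i. So the 321-avoiding permutations with a given descent set
-- correspond to pairs (Q, P) of ballot words with equally many D's such that Q
-- has that set of peaks, while P is arbitrary and hence counted by a ballot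
-- number.
--
-- A step of the inverse correspondence removes the last letter of π. To make
-- this a cons, π is replaced by its reverse-complement and Q, P are read
-- backwards. If P read backwards begins UᵗDʳ (then U or nothing), a new first
-- letter d creates no 321 iff d ≤ t + r.
module Submission where

open import Defs
open import Data.Empty using (⊥-elim)
open import Data.Fin as Fin using (Fin; zero; suc; toℕ; opposite; inject₁; punchIn; punchOut)
import Data.Fin.Properties as Fin
import Data.Integer as ℤ
import Data.Integer.Properties as ℤ
open import Data.List as List using
  (List; []; _∷_; _++_; length; cartesianProduct; concatMap; filter; upTo; foldr; allFin)
open import Data.List.Membership.Propositional using (_∈_; find; lose)
open import Data.List.Membership.Propositional.Properties
import Data.List.Properties as List
open import Data.List.Relation.Binary.Disjoint.Propositional using (Disjoint)
open import Data.List.Relation.Unary.All as All using (All; []; _∷_)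
import Data.List.Relation.Unary.All.Properties as All
import Data.List.Relation.Unary.AllPairs as AllPairs
import Data.List.Relation.Unary.AllPairs.Properties as AllPairs
open import Data.List.Relation.Unary.Any using (here; there)
open import Data.List.Relation.Unary.Unique.Propositional using () renaming (Unique to UniqueList)
import Data.List.Relation.Unary.Unique.Propositional.Properties as UniqueList
open import Data.Nat
open import Data.Nat.Combinatorics using (_C_; nC1≡n; nCk≡nC[n∸k]; nCk+nC[k+1]≡[n+1]C[k+1])
open import Data.Nat.Divisibility using (divides-refl)
open import Data.Nat.DivMod using (m<n⇒m/n≡0; m*n/n≡m; +-distrib-/-∣ˡ)
open import Data.Nat.Properties
open import Data.Nat.Solver using (module +-*-Solver)
open import Data.Product using (∃; ∃₂; _×_; _,_; proj₁; proj₂)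
import Data.Rational as ℚ
open ℚ using () renaming (_*_ to _*ℚ_)
import Data.Rational.Properties as ℚ
open import Data.Rational.Unnormalised as ℚᵘ using (mkℚᵘ; *≡*)
import Data.Rational.Unnormalised.Properties as ℚᵘ
open import Data.Sum using (_⊎_; inj₁; inj₂)
open import Data.Vec using (Vec; []; _∷_; _∷ʳ_; lookup; map; tabulate; toList)
open import Data.Vec.Properties using
  (lookup-map; lookup∘tabulate; tabulate∘lookup; tabulate-cong; ∷-injective; ∷-injectiveʳ)
open import Data.Vec.Relation.Unary.All as VAll using () renaming (All to VAll; [] to []ᵃ; _∷_ to _∷ᵃ_)
import Data.Vec.Relation.Unary.All.Properties as VAll
open import Data.Vec.Relation.Unary.AllPairs using () renaming ([] to []ᵘ; _∷_ to _∷ᵘ_)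
open import Data.Vec.Relation.Unary.Unique.Propositional using (Unique)
import Data.Vec.Relation.Unary.Unique.Propositional.Properties as Unique
open import Function using (_⇔_; mk⇔; Equivalence; _∘_; id)
open import Function.Construct.Composition using (_⇔-∘_)
open import Relation.Binary.PropositionalEquality
open import Relation.Nullary using (¬_; contradiction)
open import Relation.Unary using (_≐_)
open import Relation.Unary.Properties using (≐-sym; ≐-trans)

open Equivalence using (to; from)

private
  variable
    n x y : ℕ
    p p′ q q′ Q Q′ : Vec Letter n
    X Z : Set

-- Backward ballot words and reverse insertion

-- Height x p: p is a ballot word read backwards, with x more U's than D's.
data Height : ℕ → Vec Letter n → Set where
  []  : Height 0 []
  U∷_ : Height x p → Height (suc x) (U ∷ p)
  D∷_ : Height (suc x) p → Height x (D ∷ p)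

height≤length : {p : Vec Letter n} → Height x p → x ≤ n
height≤length []     = z≤n
height≤length (U∷ h) = s≤s (height≤length h)
height≤length (D∷ h) = m≤n⇒m≤1+n (≤-trans (n≤1+n _) (height≤length h))

-- Reverse insertion. A word read backwards lists the tableau entries from the
-- largest down, so the index d counts the entries greater than the removed one:
-- Remove deletes the largest entry of the first row; Unbump moves the largest
-- entry of the second row back to the first, where it expels its predecessor.
data Remove : Vec Letter (suc n) → Fin (suc n) → Vec Letter n → Set where
  here : Remove (U ∷ p) zero p
  D∷_  : ∀ {d} → Remove p d q → Remove (D ∷ p) (suc d) (D ∷ q)

data Unbump : Vec Letter (suc n) → Fin (suc n) → Vec Letter n → Set where
  here : ∀ {d} → Remove p d q → Unbump (D ∷ p) (suc d) (U ∷ q)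
  U∷_  : ∀ {d} → Unbump p d q → Unbump (U ∷ p) (suc d) (U ∷ q)

data Step : (p Q : Vec Letter (suc n)) → Fin (suc n) → (p₀ Q₀ : Vec Letter n) → Set where
  append : ∀ {d} → Remove p d q → Step p (U ∷ Q) d q Q
  bump   : ∀ {d} → Unbump p d q → Step p (D ∷ Q) d q Q

extend : ∀ {n} → Fin (suc n) → Vec (Fin n) n → Vec (Fin (suc n)) (suc n)
extend d σ = d ∷ map (punchIn d) σ

data RSK : (p Q : Vec Letter n) → Vec (Fin n) n → Set where
  []   : RSK [] [] []
  step : ∀ {n} {p Q : Vec Letter (suc n)} {q Q₀ d σ} →
         Step p Q d q Q₀ → RSK q Q₀ σ → RSK p Q (extend d σ)

-- label (UᵗDʳU…) = t + r and labelᴰ (DʳU…) = r.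
label labelᴰ : Vec Letter n → ℕ
label  []      = 0
label  (U ∷ p) = suc (label p)
label  (D ∷ p) = suc (labelᴰ p)
labelᴰ []      = 0
labelᴰ (U ∷ p) = 0
labelᴰ (D ∷ p) = suc (labelᴰ p)

-- Functionality, injectivity and existence of steps

remove-functional : ∀ {d d′} → Remove p d q → Remove p d′ q′ → d ≡ d′ × q ≡ q′
remove-functional here   here    = refl , refl
remove-functional (D∷ r) (D∷ r′) with refl , refl ← remove-functional r r′ = refl , refl

unbump-functional : ∀ {d d′} → Unbump p d q → Unbump p d′ q′ → d ≡ d′ × q ≡ q′
unbump-functional (here r) (here r′) with refl , refl ← remove-functional r r′ = refl , refl
unbump-functional (U∷ r)   (U∷ r′)   with refl , refl ← unbump-functional r r′ = refl , refl

step-functional : ∀ {d d′} → Step p Q d q Q′ → ∀ {r R} → Step p Q d′ r R → d ≡ d′ × q ≡ r × Q′ ≡ R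
step-functional (append r) (append r′) with refl , refl ← remove-functional r r′ = refl , refl , refl
step-functional (bump r)   (bump r′)   with refl , refl ← unbump-functional r r′ = refl , refl , refl

remove-injective : ∀ {d} → Remove p d q → Remove p′ d q → p ≡ p′
remove-injective here   here    = refl
remove-injective (D∷ r) (D∷ r′) = cong (D ∷_) (remove-injective r r′)

-- Unbumping has a positive index and leaves a word beginning with U, while a removal with positive
-- index leaves one beginning with D. So `d` and `q` alone reveal which of the two took place, hence
-- the first letter of the recording word.
remove-unbump-disjoint : ∀ {d} → Remove p d q → ¬ Unbump p′ d q
remove-unbump-disjoint here ()
remove-unbump-disjoint (D∷ _) ()

unbump-injective : ∀ {d} → Unbump p d q → Unbump p′ d q → p ≡ p′
unbump-injective (here r) (here r′) = cong (D ∷_) (remove-injective r r′)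
unbump-injective (here r) (U∷ r′)   = ⊥-elim (remove-unbump-disjoint r r′)
unbump-injective (U∷ r)   (here r′) = ⊥-elim (remove-unbump-disjoint r′ r)
unbump-injective (U∷ r)   (U∷ r′)   = cong (U ∷_) (unbump-injective r r′)

step-injective : ∀ {d} → Step p Q d q Q′ → ∀ {p′ R} → Step p′ R d q Q′ → p ≡ p′ × Q ≡ R
step-injective (append r) (append r′) = remove-injective r r′ , refl
step-injective (append r) (bump r′)   = ⊥-elim (remove-unbump-disjoint r r′)
step-injective (bump r)   (append r′) = ⊥-elim (remove-unbump-disjoint r′ r)
step-injective (bump r)   (bump r′)   = unbump-injective r r′ , refl

remove-exists : {p : Vec Letter (suc n)} → Height (suc x) p → ∃₂ λ d q → Remove p d q × Height x q
remove-exists (U∷ h) = _ , _ , here , h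
remove-exists {n = zero} (D∷ ())
remove-exists {n = suc n} (D∷ h) with d , q , r , h′ ← remove-exists h = _ , _ , D∷ r , D∷ h′

-- The bound `x ≤ n` says that the word, of length `suc n`, does not consist of U's only. Behind its
-- first D the height is positive, so a U remains to be expelled.
unbump-exists : {p : Vec Letter (suc n)} → Height x p → x ≤ n →
                ∃₂ λ d q → Unbump p d q × Height (suc x) q
unbump-exists {n = suc n} (U∷ h) (s≤s x≤n) with d , q , r , h′ ← unbump-exists h x≤n =
  _ , _ , U∷ r , U∷ h′
unbump-exists {n = suc n} (D∷ h) x≤n with d , q , r , h′ ← remove-exists h = _ , _ , here r , U∷ h′
unbump-exists {n = zero} (U∷ []) ()
unbump-exists {n = zero} (D∷ ())

step-exists : {p Q : Vec Letter (suc n)} → Height x p → Height x Q →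
              ∃₂ λ d q → ∃₂ λ Q₀ y → Step p Q d q Q₀ × Height y q × Height y Q₀
step-exists hp (U∷ hQ) with d , q , r , h ← remove-exists hp = _ , _ , _ , _ , append r , h , hQ
-- The tail of `Q` has height `suc x`, at most its length `n`; so `p`, of the same height `x` as
-- `Q`, contains a D to unbump.
step-exists hp (D∷ hQ) with d , q , r , h ← unbump-exists hp (≤-trans (n≤1+n _) (height≤length hQ)) =
  _ , _ , _ , _ , bump r , h , hQ

remove-height : ∀ {d} → Remove p d q → Height x q → Height (suc x) p
remove-height here   h      = U∷ h
remove-height (D∷ r) (D∷ h) = D∷ (remove-height r h)

unbump-height : ∀ {d} → Unbump p d q → Height (suc x) q → Height x p
unbump-height (here r)          (U∷ h)        = D∷ (remove-height r h)
-- Splitting `r` exposes that the word left by unbumping begins with U, so its height is positive,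
-- as the recursive call demands.
unbump-height (U∷ r@(here _))   (U∷ h@(U∷ _)) = U∷ unbump-height r h
unbump-height (U∷ r@(U∷ _))     (U∷ h@(U∷ _)) = U∷ unbump-height r h

step-height : ∀ {d} → Step p Q d q Q′ → Height x q → Height x Q′ → ∃ λ y → Height y p × Height y Q
step-height (append r) hp hQ = _ , remove-height r hp , U∷ hQ
step-height {x = suc x} (bump r)   hp hQ = _ , unbump-height r hp , D∷ hQ
step-height {x = zero}  (bump (here _)) () hQ
step-height {x = zero}  (bump (U∷ _)) () hQ

remove-insert : (q : Vec Letter n) (d : Fin (suc n)) → toℕ d ≤ labelᴰ q → ∃ λ p → Remove p d q
remove-insert q       zero    _         = _ , here
remove-insert (D ∷ q) (suc d) (s≤s d≤h) with p , r ← remove-insert q d d≤h = _ , D∷ r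

-- Each leading U peeled off uses up one unit of `d`, until `d` is zero or the D's are reached,
-- where a removal exists. The first U put back turns it into an unbumping, which the further U's
-- only lengthen.
remove-or-unbump-insert : (q : Vec Letter n) (d : Fin (suc n)) → toℕ d ≤ label q →
           (∃ λ p → Remove p d q) ⊎ (∃ λ p → Unbump p d q)
remove-or-unbump-insert q       zero    _         = inj₁ (_ , here)
remove-or-unbump-insert (D ∷ q) (suc d) d≤h       = inj₁ (remove-insert (D ∷ q) (suc d) d≤h)
remove-or-unbump-insert (U ∷ q) (suc d) (s≤s d≤h) with remove-or-unbump-insert q d d≤h
... | inj₁ (p , r) = inj₂ (_ , here r)
... | inj₂ (p , r) = inj₂ (_ , U∷ r)

step-insert : (q Q : Vec Letter n) (d : Fin (suc n)) → toℕ d ≤ label q → ∃₂ λ p R → Step p R d q Q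
step-insert q Q d d≤h with remove-or-unbump-insert q d d≤h
... | inj₁ (p , r) = _ , _ , append r
... | inj₂ (p , r) = _ , _ , bump r

-- Labels, indices and descents

remove-≤ : ∀ {d} → Remove p d q → toℕ d ≤ labelᴰ q
remove-≤ here   = z≤n
remove-≤ (D∷ r) = s≤s (remove-≤ r)

labelᴰ≤label : (p : Vec Letter n) → labelᴰ p ≤ label p
labelᴰ≤label []      = z≤n
labelᴰ≤label (U ∷ p) = z≤n
labelᴰ≤label (D ∷ p) = ≤-refl

unbump-≤ : ∀ {d} → Unbump p d q → toℕ d ≤ label q
unbump-≤ {q = _ ∷ q} (here r) = s≤s (≤-trans (remove-≤ r) (labelᴰ≤label q))
unbump-≤ (U∷ r)   = s≤s (unbump-≤ r)

step-≤ : ∀ {d} → Step p Q d q Q′ → toℕ d ≤ label q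
step-≤ {q = q} (append r) = ≤-trans (remove-≤ r) (labelᴰ≤label q)
step-≤ (bump r) = unbump-≤ r

remove-label : ∀ {d} → Remove p d q → labelᴰ p ≡ toℕ d
remove-label here   = refl
remove-label (D∷ r) = cong suc (remove-label r)

-- The expelled U ends the first run of D's in `p`, so `d` counts exactly the prefix UᵗDʳ that
-- `label` measures.
unbump-label : ∀ {d} → Unbump p d q → label p ≡ toℕ d
unbump-label (here r) = cong suc (remove-label r)
unbump-label (U∷ r)   = cong suc (unbump-label r)

step-label-zero : Step p Q zero q Q′ → label p ≡ suc (label q)
step-label-zero (append here) = refl

step-label-suc : ∀ {d} → Step p Q (suc d) q Q′ → label p ≡ suc (toℕ d)
step-label-suc (append (D∷ r)) = cong suc (remove-label r)
step-label-suc (bump r)        = unbump-label r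

-- An index is at most the preceding label, and a nonzero index e leaves the
-- label e. So the index can exceed its predecessor e only if e is zero.
step-descent : ∀ {n} {p Q : Vec Letter (suc (suc n))} {q Q₀ r R₀} {d e} →
               Step p Q d q Q₀ → Step q Q₀ e r R₀ →
               (toℕ e < toℕ d) ⇔ (lookup Q zero ≡ D × lookup Q (suc zero) ≡ U)
step-descent (append here)   t = mk⇔ (λ ()) (λ ())
step-descent (append (D∷ r)) (append (D∷ t)) = mk⇔
  (λ e<d → ⊥-elim (<⇒≱ e<d (s≤s (≤-trans (remove-≤ r) (≤-reflexive (remove-label t)))))) (λ ())
step-descent (append (D∷ r)) (bump (here t)) = mk⇔
  (λ e<d → ⊥-elim (<⇒≱ e<d (s≤s (≤-trans (remove-≤ r) (≤-reflexive (remove-label t)))))) (λ ())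
step-descent (bump (here r)) (append here) = mk⇔ (λ _ → refl , refl) (λ _ → s≤s z≤n)
step-descent (bump (U∷ r))   (append here) = mk⇔ (λ _ → refl , refl) (λ _ → s≤s z≤n)
step-descent (bump r)        (bump t) = mk⇔
  (λ e<d → ⊥-elim (<⇒≱ e<d (≤-trans (unbump-≤ r) (≤-reflexive (unbump-label t))))) (λ ())

-- The permutation built along the steps

punchIn-< : ∀ (d : Fin (suc n)) i → toℕ i < toℕ d → toℕ (punchIn d i) ≡ toℕ i
punchIn-< (suc d) zero    _         = refl
punchIn-< (suc d) (suc i) (s≤s i<d) = cong suc (punchIn-< d i i<d)

punchIn-≥ : ∀ (d : Fin (suc n)) i → toℕ d ≤ toℕ i → toℕ (punchIn d i) ≡ suc (toℕ i)
punchIn-≥ zero    i       _         = refl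
punchIn-≥ (suc d) (suc i) (s≤s d≤i) = cong suc (punchIn-≥ d i d≤i)

punchIn<⇔< : ∀ (d : Fin (suc n)) i → (toℕ (punchIn d i) < toℕ d) ⇔ (toℕ i < toℕ d)
punchIn<⇔< d i = mk⇔
  (λ lt → ≰⇒> λ d≤i → <⇒≱ lt (≤-trans (m≤n⇒m≤1+n d≤i) (≤-reflexive (sym (punchIn-≥ d i d≤i)))))
  (λ lt → subst (_< toℕ d) (sym (punchIn-< d i lt)) lt)

punchIn-<⇔ : ∀ (d : Fin (suc n)) i j → (toℕ (punchIn d i) < toℕ (punchIn d j)) ⇔ (toℕ i < toℕ j)
punchIn-<⇔ d i j = mk⇔
  (λ lt → ≰⇒> λ j≤i → <⇒≱ lt (Fin.punchIn-mono-≤ d j i j≤i))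
  (λ lt → ≰⇒> λ j≤i → <⇒≱ lt (Fin.punchIn-cancel-≤ d j i j≤i))

-- h is the least top of an inversion, or n if there is none.
record Invariant (σ : Vec (Fin n) n) (h : ℕ) : Set where
  field
    avoids   : ¬ Has321 σ
    tops     : ∀ i j → toℕ i < toℕ j → toℕ (lookup σ j) < toℕ (lookup σ i) → h ≤ toℕ (lookup σ i)
    attained : h < n → ∃₂ λ i j →
               toℕ i < toℕ j × toℕ (lookup σ j) < toℕ (lookup σ i) × toℕ (lookup σ i) ≡ h
    minimum  : 0 < n → ∃ λ i → toℕ (lookup σ i) ≡ 0

module _ {n} (d : Fin (suc n)) (σ : Vec (Fin n) n) where

  inversion-map : ∀ i j →
    (toℕ (lookup (map (punchIn d) σ) j) < toℕ (lookup (map (punchIn d) σ) i)) ⇔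
    (toℕ (lookup σ j) < toℕ (lookup σ i))
  inversion-map i j rewrite lookup-map i (punchIn d) σ | lookup-map j (punchIn d) σ =
    punchIn-<⇔ d (lookup σ j) (lookup σ i)

  inversion-head : ∀ j → (toℕ (lookup (map (punchIn d) σ) j) < toℕ d) ⇔ (toℕ (lookup σ j) < toℕ d)
  inversion-head j rewrite lookup-map j (punchIn d) σ = punchIn<⇔< d (lookup σ j)

  -- A 321 starting at the new letter `d` would need an inversion of `σ` with top below `d`.
  extend-avoids : ∀ {h} → Invariant σ h → toℕ d ≤ h → ¬ Has321 (extend d σ)
  extend-avoids inv d≤h (zero , suc j , suc l , i<j , s≤s j<l , dj , jl) =
    <⇒≱ (to (inversion-head j) dj) (≤-trans d≤h (Invariant.tops inv j l j<l (to (inversion-map j l) jl)))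
  extend-avoids inv d≤h (suc i , suc j , suc l , s≤s i<j , s≤s j<l , ij , jl) =
    Invariant.avoids inv (i , j , l , i<j , j<l , to (inversion-map i j) ij , to (inversion-map j l) jl)

  avoids-tail : ¬ Has321 (extend d σ) → ¬ Has321 σ
  avoids-tail av (i , j , l , i<j , j<l , ij , jl) =
    av (suc i , suc j , suc l , s≤s i<j , s≤s j<l ,
        from (inversion-map i j) ij , from (inversion-map j l) jl)

  -- If `h < d`, an inversion with top `h` completes to a 321 with `d` in front; `d ≤ n` supplies
  -- the `h < n` that `attained` asks for.
  avoids-≤ : ∀ {h} → Invariant σ h → ¬ Has321 (extend d σ) → toℕ d ≤ h
  avoids-≤ inv av = ≮⇒≥ λ h<d → let
      i , j , i<j , inv< , e = Invariant.attained inv (<-≤-trans h<d (Fin.toℕ≤pred[n] d))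
    in av (zero , suc i , suc j , s≤s z≤n , s≤s i<j ,
           from (inversion-head i) (subst (_< toℕ d) (sym e) h<d) , from (inversion-map i j) inv<)

-- A zero in front starts no inversion and raises all old tops by one. A nonzero `d` exceeds the
-- later letter 0, so it is itself a top; it is the least one, because `d ≤ label q` and `punchIn`
-- shifts the old tops above it.
extend-invariant : ∀ {n} {p Q : Vec Letter (suc n)} {q Q₀ d} {σ : Vec (Fin n) n} → Step p Q d q Q₀ →
                   Invariant σ (label q) → Invariant (extend d σ) (label p)
Invariant.avoids (extend-invariant {d = d} {σ} s inv) = extend-avoids d σ inv (step-≤ s)
Invariant.tops (extend-invariant {d = zero} {σ} s inv) zero (suc j) _ ()
Invariant.tops (extend-invariant {d = suc d} {σ} s inv) zero (suc j) _ _ = ≤-reflexive (step-label-suc s)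
Invariant.tops (extend-invariant {d = zero} {σ} s inv) (suc i) (suc j) (s≤s i<j) lt
  rewrite step-label-zero s | lookup-map i (punchIn zero) σ | lookup-map j (punchIn zero) σ with lt
... | s≤s lt = s≤s (Invariant.tops inv i j i<j lt)
Invariant.tops (extend-invariant {d = suc d} {σ} s inv) (suc i) (suc j) (s≤s i<j) lt
  with ≤i ← ≤-trans (step-≤ s) (Invariant.tops inv i j i<j (to (inversion-map (suc d) σ i j) lt))
  rewrite step-label-suc s | lookup-map i (punchIn (suc d)) σ | punchIn-≥ (suc d) (lookup σ i) ≤i =
  m≤n⇒m≤1+n ≤i
Invariant.attained (extend-invariant {d = zero} {σ} s inv) h<n rewrite step-label-zero s with h<n
... | s≤s h<n with i , j , i<j , lt , e ← Invariant.attained inv h<n =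
  suc i , suc j , s≤s i<j , from (inversion-map zero σ i j) lt ,
  trans (cong toℕ (lookup-map i suc σ)) (cong suc e)
Invariant.attained (extend-invariant {n = suc n} {d = suc d} {σ} s inv) _
  with i , e ← Invariant.minimum inv (s≤s z≤n) =
  zero , suc i , s≤s z≤n ,
  from (inversion-head (suc d) σ i) (subst (_< suc (toℕ d)) (sym e) (s≤s z≤n)) ,
  sym (step-label-suc s)
Invariant.minimum (extend-invariant {d = zero} s inv) _ = zero , refl
Invariant.minimum (extend-invariant {n = suc n} {d = suc d} {σ} s inv) _
  with i , e ← Invariant.minimum inv (s≤s z≤n) =
  suc i , trans (cong toℕ (lookup-map i (punchIn (suc d)) σ))
    (trans (punchIn-< (suc d) (lookup σ i) (subst (_< suc (toℕ d)) (sym e) (s≤s z≤n))) e)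

rsk-invariant : ∀ {σ} → RSK p Q σ → Invariant σ (label p)
rsk-invariant [] = record { avoids = λ () ; tops = λ () ; attained = λ () ; minimum = λ () }
rsk-invariant (step s r) = extend-invariant s (rsk-invariant r)

-- Descents and bijectivity

rsk-descents : ∀ {p Q : Vec Letter n} {σ} → RSK p Q σ → ∀ i j → toℕ j ≡ suc (toℕ i) →
               (toℕ (lookup σ j) < toℕ (lookup σ i)) ⇔ (lookup Q i ≡ D × lookup Q j ≡ U)
rsk-descents (step s (step {d = e} {σ} t r)) zero (suc zero) refl = mk⇔
  (λ lt → to (step-descent s t) (to (punchIn<⇔< _ e) lt))
  (λ du → from (punchIn<⇔< _ e) (from (step-descent s t) du))
rsk-descents (step {d = d} {σ} (append _) r) (suc i) (suc j) eq =
  rsk-descents r i j (suc-injective eq) ⇔-∘ inversion-map d σ i j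
rsk-descents (step {d = d} {σ} (bump _) r) (suc i) (suc j) eq =
  rsk-descents r i j (suc-injective eq) ⇔-∘ inversion-map d σ i j

rsk-functional : ∀ {p Q : Vec Letter n} {σ τ} → RSK p Q σ → RSK p Q τ → σ ≡ τ
rsk-functional []         []           = refl
rsk-functional (step s r) (step s′ r′) with refl , refl , refl ← step-functional s s′ =
  cong (extend _) (rsk-functional r r′)

map-injective : ∀ {A B : Set} {f : A → B} → (∀ {x y} → f x ≡ f y → x ≡ y) →
                {xs ys : Vec A n} → map f xs ≡ map f ys → xs ≡ ys
map-injective inj {[]}     {[]}     _  = refl
map-injective inj {x ∷ xs} {y ∷ ys} eq with e , es ← ∷-injective eq =
  cong₂ _∷_ (inj e) (map-injective inj es)

-- The equation between the permutations is a separate argument because two indices of the form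
-- `extend d σ` cannot be matched directly. Comparing first letters and cancelling `punchIn d`
-- passes it on to the tails.
rsk-injective : ∀ {p Q p′ Q′ : Vec Letter n} {σ τ} → RSK p Q σ → RSK p′ Q′ τ → σ ≡ τ → p ≡ p′ × Q ≡ Q′
rsk-injective [] [] _ = refl , refl
rsk-injective (step {d = d} s r) (step s′ r′) eq with refl , es ← ∷-injective eq
  with refl , refl ← rsk-injective r r′ (map-injective (Fin.punchIn-injective d _ _) es) = step-injective s s′

rsk-exists : {p Q : Vec Letter n} → Height x p → Height x Q → ∃ λ σ → RSK p Q σ
rsk-exists {zero} {p = []} {[]} [] [] = _ , []
rsk-exists {suc n} hp hQ with d , q , Q₀ , y , s , h , h′ ← step-exists hp hQ
  with σ , r ← rsk-exists h h′ = _ , step s r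

rsk-height : {p Q : Vec Letter n} {σ : Vec (Fin n) n} → RSK p Q σ → ∃ λ y → Height y p × Height y Q
rsk-height [] = _ , [] , []
rsk-height (step s r) with y , h , h′ ← rsk-height r = step-height s h h′

unpunch : (d : Fin (suc n)) {m : ℕ}
          (τ : Vec (Fin (suc n)) m) → VAll (d ≢_) τ → ∃ λ σ → τ ≡ map (punchIn d) σ
unpunch d []      _           = _ , refl
unpunch d (x ∷ τ) (d≢x ∷ᵃ d≢) with σ , refl ← unpunch d τ d≢ =
  punchOut d≢x ∷ σ , cong (_∷ _) (sym (Fin.punchIn-punchOut d≢x))

unique-map⁻ : ∀ {A B : Set} {f : A → B} {xs : Vec A n} → Unique (map f xs) → Unique xs
unique-map⁻ {xs = []}        _          = []ᵘ
unique-map⁻ {f = f} {x ∷ xs} (x≢ ∷ᵘ u) = VAll.map (_∘ cong f) (VAll.map⁻ x≢) ∷ᵘ unique-map⁻ u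

-- Avoidance keeps the first letter within the label of the word for the tail, which is the range in
-- which `step-insert` finds a step.
rsk-surjective : (σ : Vec (Fin n) n) → Unique σ → ¬ Has321 σ → ∃₂ λ p Q → RSK p Q σ
rsk-surjective [] _ _ = _ , _ , []
rsk-surjective (d ∷ τ) (d≢ ∷ᵘ u) av with σ , refl ← unpunch d τ d≢
  with q , Q₀ , r ← rsk-surjective σ (unique-map⁻ u) (avoids-tail d σ av)
  with p , Q , s ← step-insert q Q₀ d (avoids-≤ d σ (rsk-invariant r) av) = p , Q , step s r

rsk-unique : {p Q : Vec Letter n} {σ : Vec (Fin n) n} → RSK p Q σ → Unique σ
rsk-unique [] = []ᵘ
rsk-unique (step {d = d} s r) =
  VAll.map⁺ (VAll.universal (λ i → Fin.punchInᵢ≢i d i ∘ sym) _) ∷ᵘ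
  Unique.map⁺ (Fin.punchIn-injective d _ _) (rsk-unique r)

-- Counting ballot words

-- Subtraction-free form of (k+1)C(n,k+1) = (n-k)C(n,k), proved from Pascal's rule.
absorption : ∀ n k → suc k * (n C suc k) + k * (n C k) ≡ n * (n C k)
absorption zero    zero    = refl
absorption zero    (suc k) = cong₂ _+_ (*-zeroʳ k) (*-zeroʳ k)
absorption (suc n) zero    = trans (+-identityʳ _)
  (trans (+-identityʳ _) (trans (nC1≡n (suc n)) (sym (*-identityʳ (suc n)))))
absorption (suc n) (suc k)
  rewrite sym (nCk+nC[k+1]≡[n+1]C[k+1] n k) | sym (nCk+nC[k+1]≡[n+1]C[k+1] n (suc k)) = begin
  (2 + k) * (b + c) + (1 + k) * (a + b)
    ≡⟨ solve 4 (λ k a b c → (con 2 :+ k) :* (b :+ c) :+ (con 1 :+ k) :* (a :+ b) :=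
         (((con 2 :+ k) :* c :+ (con 1 :+ k) :* b) :+ ((con 1 :+ k) :* b :+ k :* a)) :+ (a :+ b)) refl k a b c ⟩
  (2 + k) * c + (1 + k) * b + ((1 + k) * b + k * a) + (a + b)
    ≡⟨ cong (_+ (a + b)) (cong₂ _+_ (absorption n (suc k)) (absorption n k)) ⟩
  n * b + n * a + (a + b)
    ≡⟨ solve 3 (λ n a b → n :* b :+ n :* a :+ (a :+ b) := (con 1 :+ n) :* (a :+ b)) refl n a b ⟩
  suc n * (a + b) ∎
  where
  open ≡-Reasoning
  open +-*-Solver
  a = n C k
  b = n C suc k
  c = n C (2 + k)

ballots : ∀ n → ℕ → List (Vec Letter n)
ballots zero    zero    = [] ∷ []
ballots zero    (suc x) = []
ballots (suc n) zero    = List.map (D ∷_) (ballots n 1)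
ballots (suc n) (suc x) = List.map (U ∷_) (ballots n x) ++ List.map (D ∷_) (ballots n (2 + x))

∈-ballots⁺ : {p : Vec Letter n} → Height x p → p ∈ ballots n x
∈-ballots⁺ []                = here refl
∈-ballots⁺ (U∷ h)            = ∈-++⁺ˡ (∈-map⁺ (U ∷_) (∈-ballots⁺ h))
∈-ballots⁺ {x = zero}  (D∷ h) = ∈-map⁺ (D ∷_) (∈-ballots⁺ h)
∈-ballots⁺ {x = suc x} (D∷ h) = ∈-++⁺ʳ _ (∈-map⁺ (D ∷_) (∈-ballots⁺ h))

∈-ballots⁻ : ∀ x {p : Vec Letter n} → p ∈ ballots n x → Height x p
∈-ballots⁻ {zero}  zero    (here refl) = []
∈-ballots⁻ {suc n} zero    p∈ with q , q∈ , refl ← ∈-map⁻ (D ∷_) p∈ = D∷ ∈-ballots⁻ 1 q∈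
∈-ballots⁻ {suc n} (suc x) p∈ with ∈-++⁻ (List.map (U ∷_) (ballots n x)) p∈
... | inj₁ p∈ᵁ with q , q∈ , refl ← ∈-map⁻ (U ∷_) p∈ᵁ = U∷ ∈-ballots⁻ x q∈
... | inj₂ p∈ᴰ with q , q∈ , refl ← ∈-map⁻ (D ∷_) p∈ᴰ = D∷ ∈-ballots⁻ (2 + x) q∈

ballots-unique : ∀ n x → UniqueList (ballots n x)
ballots-unique zero    zero    = [] AllPairs.∷ AllPairs.[]
ballots-unique zero    (suc x) = AllPairs.[]
ballots-unique (suc n) zero    = UniqueList.map⁺ ∷-injectiveʳ (ballots-unique n 1)
ballots-unique (suc n) (suc x) = UniqueList.++⁺
  (UniqueList.map⁺ ∷-injectiveʳ (ballots-unique n x))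
  (UniqueList.map⁺ ∷-injectiveʳ (ballots-unique n (2 + x)))
  λ (v∈ᵁ , v∈ᴰ) → U≢D (trans (sym (proj₂ (proj₂ (∈-map⁻ _ v∈ᵁ)))) (proj₂ (proj₂ (∈-map⁻ _ v∈ᴰ))))
  where
  U≢D : {p q : Vec Letter n} → ¬ U ∷ p ≡ D ∷ q
  U≢D ()

∣ballots∣ : ℕ → ℕ → ℕ
∣ballots∣ n x = length (ballots n x)

∣ballots∣-step : ∀ n x → ∣ballots∣ (suc n) (suc x) ≡ ∣ballots∣ n x + ∣ballots∣ n (2 + x)
∣ballots∣-step n x = trans (List.length-++ (List.map (U ∷_) (ballots n x)))
  (cong₂ _+_ (List.length-map _ (ballots n x)) (List.length-map _ (ballots n (2 + x))))

∣ballots∣-zero : ∀ {n x} → n < x → ∣ballots∣ n x ≡ 0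
∣ballots∣-zero {zero}  {suc x} _         = refl
∣ballots∣-zero {suc n} {suc x} (s≤s n<x) =
  trans (∣ballots∣-step n x) (cong₂ _+_ (∣ballots∣-zero n<x) (∣ballots∣-zero (m<n⇒m<1+n (m<n⇒m<1+n n<x))))

-- n C⁻ k is n C (k - 1), which is 0 for k = 0.
_C⁻_ : ℕ → ℕ → ℕ
n C⁻ zero  = 0
n C⁻ suc k = n C k

C⁻-pascal : ∀ n k → n C⁻ k + n C k ≡ suc n C k
C⁻-pascal n zero    = refl
C⁻-pascal n (suc k) = nCk+nC[k+1]≡[n+1]C[k+1] n k

-- At height 0 the recursion for `ballots` has no term for U; the equality of the two middle
-- binomials fills this gap in the reflection formula.
middle-C : ∀ a → suc (2 * a) C a ≡ suc (2 * a) C suc a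
middle-C a = trans (nCk≡nC[n∸k] (m≤n⇒m≤1+n (m≤n*m a 2))) (cong (suc (2 * a) C_) (begin
  suc (2 * a) ∸ a     ≡⟨ cong (λ z → suc (a + z) ∸ a) (+-identityʳ a) ⟩
  suc a + a ∸ a       ≡⟨ m+n∸n≡m (suc a) a ⟩
  suc a               ∎))
  where open ≡-Reasoning

-- The reflection principle |ballots n x| = C(n, a) - C(n, a - 1).
∣ballots∣-C : ∀ n x a → n ≡ x + 2 * a → ∣ballots∣ n x + n C⁻ a ≡ n C a
∣ballots∣-C zero    zero    zero    _  = refl
∣ballots∣-C (suc n) zero    (suc a) eq = begin
  length (List.map (D ∷_) (ballots n 1)) + suc n C a
    ≡⟨ cong₂ _+_ (List.length-map _ (ballots n 1)) (sym (C⁻-pascal n a)) ⟩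
  ∣ballots∣ n 1 + (n C⁻ a + n C a)
    ≡⟨ +-assoc (∣ballots∣ n 1) (n C⁻ a) (n C a) ⟨
  ∣ballots∣ n 1 + n C⁻ a + n C a
    ≡⟨ cong₂ _+_ (∣ballots∣-C n 1 a n≡) (subst (λ m → m C a ≡ m C suc a) (sym n≡) (middle-C a)) ⟩
  n C a + n C suc a
    ≡⟨ nCk+nC[k+1]≡[n+1]C[k+1] n a ⟩
  suc n C suc a ∎
  where
  open ≡-Reasoning
  n≡ : n ≡ 1 + 2 * a
  n≡ = trans (suc-injective eq) (+-suc a (a + 0))
∣ballots∣-C (suc n) (suc x) zero eq = begin
  ∣ballots∣ (suc n) (suc x) + 0          ≡⟨ cong (_+ 0) (∣ballots∣-step n x) ⟩
  ∣ballots∣ n x + ∣ballots∣ n (2 + x) + 0 ≡⟨ cong (λ z → ∣ballots∣ n x + z + 0) (∣ballots∣-zero n<2+x) ⟩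
  ∣ballots∣ n x + 0 + 0                  ≡⟨ cong (_+ 0) (∣ballots∣-C n x 0 (suc-injective eq)) ⟩
  n C 0 + 0                              ≡⟨⟩
  suc n C 0                              ∎
  where
  open ≡-Reasoning
  n<2+x : n < 2 + x
  n<2+x = s≤s (≤-trans (≤-reflexive (trans (suc-injective eq) (+-identityʳ x))) (n≤1+n x))
∣ballots∣-C (suc n) (suc x) (suc a) eq = begin
  ∣ballots∣ (suc n) (suc x) + suc n C a
    ≡⟨ cong₂ _+_ (∣ballots∣-step n x) (sym (C⁻-pascal n a)) ⟩
  b₁ + b₂ + (n C⁻ a + n C a)
    ≡⟨ solve 4 (λ b₁ b₂ c d → b₁ :+ b₂ :+ (c :+ d) := (b₂ :+ c) :+ (b₁ :+ d))
         refl b₁ b₂ (n C⁻ a) (n C a) ⟩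
  (b₂ + n C⁻ a) + (b₁ + n C a)
    ≡⟨ cong₂ _+_ (∣ballots∣-C n (2 + x) a n≡) (∣ballots∣-C n x (suc a) (suc-injective eq)) ⟩
  n C a + n C suc a
    ≡⟨ nCk+nC[k+1]≡[n+1]C[k+1] n a ⟩
  suc n C suc a ∎
  where
  open ≡-Reasoning
  open +-*-Solver
  b₁ = ∣ballots∣ n x
  b₂ = ∣ballots∣ n (2 + x)
  n≡ : n ≡ 2 + x + 2 * a
  n≡ = trans (suc-injective eq)
    (solve 2 (λ x a → x :+ con 2 :* (con 1 :+ a) := con 2 :+ x :+ con 2 :* a) refl x a)

-- For N = x + 2a and k = a - 1 this is (N-k)C(N,k) = (k+1)C(N,k+1), as N - k = x + a + 1. Adding
-- kC(N,k) to both sides brings it to the form of `absorption`.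
C⁻-absorption : ∀ x a → suc (x + a) * ((x + 2 * a) C⁻ a) ≡ a * ((x + 2 * a) C a)
C⁻-absorption x zero    = *-zeroʳ (suc (x + 0))
C⁻-absorption x (suc k) = +-cancelʳ-≡ (k * (N C k)) _ _ (begin
  suc (x + suc k) * (N C k) + k * (N C k)
    ≡⟨ solve 3 (λ x k c → (con 1 :+ (x :+ (con 1 :+ k))) :* c :+ k :* c :=
         (x :+ con 2 :* (con 1 :+ k)) :* c) refl x k (N C k) ⟩
  N * (N C k)
    ≡⟨ absorption N k ⟨
  suc k * (N C suc k) + k * (N C k) ∎)
  where
  open ≡-Reasoning
  open +-*-Solver
  N = x + 2 * suc k

-- The reflection formula multiplied by N - a + 1 = x + a + 1, where N = x + 2a: the ballot number
-- with its denominator cleared.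
∣ballots∣-closed : ∀ x a → suc x * ((x + 2 * a) C a) ≡ ∣ballots∣ (x + 2 * a) x * suc (x + a)
∣ballots∣-closed x a = +-cancelʳ-≡ (a * (N C a)) _ _ (begin
  suc x * (N C a) + a * (N C a)
    ≡⟨ *-distribʳ-+ (N C a) (suc x) a ⟨
  suc (x + a) * (N C a)
    ≡⟨ cong (suc (x + a) *_) (∣ballots∣-C N x a refl) ⟨
  suc (x + a) * (b + N C⁻ a)
    ≡⟨ *-distribˡ-+ (suc (x + a)) b (N C⁻ a) ⟩
  suc (x + a) * b + suc (x + a) * (N C⁻ a)
    ≡⟨ cong₂ _+_ (*-comm (suc (x + a)) b) (C⁻-absorption x a) ⟩
  b * suc (x + a) + a * (N C a) ∎)
  where
  open ≡-Reasoning
  N = x + 2 * a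
  b = ∣ballots∣ N x

-- Passage to the rationals

toℚᵘ-fromℕ : ∀ i → ℚ.toℚᵘ (fromℕ i) ℚᵘ.≃ mkℚᵘ (ℤ.+ i) 0
toℚᵘ-fromℕ i = ℚ.toℚᵘ-fromℚᵘ (mkℚᵘ (ℤ.+ i) 0)

fromℕ-+ : ∀ i j → fromℕ (i + j) ≡ fromℕ i ℚ.+ fromℕ j
fromℕ-+ i j = ℚ.toℚᵘ-injective (begin
  ℚ.toℚᵘ (fromℕ (i + j))                  ≈⟨ toℚᵘ-fromℕ (i + j) ⟩
  mkℚᵘ (ℤ.+ (i + j)) 0                    ≈⟨ *≡* (cong (ℤ._* ℤ.+ 1) (cong₂ ℤ._+_ (unit i) (unit j))) ⟩
  mkℚᵘ (ℤ.+ i) 0 ℚᵘ.+ mkℚᵘ (ℤ.+ j) 0      ≈⟨ ℚᵘ.+-cong (toℚᵘ-fromℕ i) (toℚᵘ-fromℕ j) ⟨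
  ℚ.toℚᵘ (fromℕ i) ℚᵘ.+ ℚ.toℚᵘ (fromℕ j)  ≈⟨ ℚ.toℚᵘ-homo-+ (fromℕ i) (fromℕ j) ⟨
  ℚ.toℚᵘ (fromℕ i ℚ.+ fromℕ j)            ∎)
  where
  open ℚᵘ.≃-Reasoning
  unit : ∀ l → ℤ.+ l ≡ ℤ.+ l ℤ.* ℤ.+ 1
  unit l = sym (ℤ.*-identityʳ (ℤ.+ l))

-- Equality of unnormalised rationals is equality of cross products, so no fraction has to be
-- reduced and only the hypothesis on natural numbers remains.
/-*-fromℕ : ∀ i d j b → i * j ≡ b * suc d → (ℤ.+ i ℚ./ suc d) ℚ.* fromℕ j ≡ fromℕ b
/-*-fromℕ i d j b eq = ℚ.toℚᵘ-injective (begin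
  ℚ.toℚᵘ ((ℤ.+ i ℚ./ suc d) ℚ.* fromℕ j)          ≈⟨ ℚ.toℚᵘ-homo-* (ℤ.+ i ℚ./ suc d) (fromℕ j) ⟩
  ℚ.toℚᵘ (ℤ.+ i ℚ./ suc d) ℚᵘ.* ℚ.toℚᵘ (fromℕ j)  ≈⟨ ℚᵘ.*-cong (ℚ.toℚᵘ-fromℚᵘ (mkℚᵘ (ℤ.+ i) d)) (toℚᵘ-fromℕ j) ⟩
  mkℚᵘ (ℤ.+ i) d ℚᵘ.* mkℚᵘ (ℤ.+ j) 0              ≈⟨ *≡* cross ⟩
  mkℚᵘ (ℤ.+ b) 0                                  ≈⟨ toℚᵘ-fromℕ b ⟨
  ℚ.toℚᵘ (fromℕ b)                                ∎)
  where
  open ℚᵘ.≃-Reasoning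
  cross : ℤ.+ i ℤ.* ℤ.+ j ℤ.* ℤ.+ 1 ≡ ℤ.+ b ℤ.* ℤ.+ (suc d * 1)
  cross = trans (ℤ.*-identityʳ (ℤ.+ i ℤ.* ℤ.+ j)) (trans (sym (ℤ.pos-* i j))
    (trans (cong ℤ.+_ (trans eq (cong (b *_) (sym (*-identityʳ (suc d)))))) (ℤ.pos-* b (suc d * 1))))

fromℕ-* : ∀ i j → fromℕ (i * j) ≡ fromℕ i ℚ.* fromℕ j
fromℕ-* i j = sym (/-*-fromℕ i 0 j (i * j) (sym (*-identityʳ (i * j))))

ballotNumber≡ : ∀ n a → 2 * a ≤ n → ballotNumber n a ≡ fromℕ (∣ballots∣ n (n ∸ 2 * a))
ballotNumber≡ n a 2a≤n = /-*-fromℕ (h + 1) (n ∸ a) (n C a) (∣ballots∣ n h) (begin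
  (h + 1) * (n C a)                      ≡⟨ cong (_* (n C a)) (+-comm h 1) ⟩
  suc h * (n C a)                        ≡⟨ cong (λ m → suc h * (m C a)) n≡ ⟩
  suc h * ((h + 2 * a) C a)              ≡⟨ ∣ballots∣-closed h a ⟩
  ∣ballots∣ (h + 2 * a) h * suc (h + a)  ≡⟨ cong₂ (λ m d → ∣ballots∣ m h * suc d) n≡ n∸a≡ ⟨
  ∣ballots∣ n h * suc (n ∸ a)            ∎)
  where
  open ≡-Reasoning
  h = n ∸ 2 * a
  n≡ : n ≡ h + 2 * a
  n≡ = sym (m∸n+n≡m 2a≤n)
  n∸a≡ : n ∸ a ≡ h + a
  n∸a≡ = begin
    n ∸ a            ≡⟨ cong (_∸ a) n≡ ⟩
    h + 2 * a ∸ a    ≡⟨ cong (λ z → h + (a + z) ∸ a) (+-identityʳ a) ⟩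
    h + (a + a) ∸ a  ≡⟨ cong (_∸ a) (+-assoc h a a) ⟨
    h + a + a ∸ a    ≡⟨ m+n∸n≡m (h + a) a ⟩
    h + a            ∎

-- Lengths of products, unions and injections

length-cartesianProduct : (xs : List X) (zs : List Z) → length (cartesianProduct xs zs) ≡ length xs * length zs
length-cartesianProduct []       zs = refl
length-cartesianProduct (x ∷ xs) zs = trans (List.length-++ (List.map (x ,_) zs))
  (cong₂ _+_ (List.length-map (x ,_) zs) (length-cartesianProduct xs zs))

fromℕ-length-concatMap : (f : ℕ → ℚ.ℚ) (g : ℕ → List X) (as : List ℕ) →
  All (λ a → fromℕ (length (g a)) ≡ f a) as →
  fromℕ (length (concatMap g as)) ≡ foldr ℚ._+_ ℚ.0ℚ (List.map f as)
fromℕ-length-concatMap f g []       []         = refl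
fromℕ-length-concatMap f g (a ∷ as) (eq ∷ eqs) = begin
  fromℕ (length (g a ++ concatMap g as))
    ≡⟨ cong fromℕ (List.length-++ (g a)) ⟩
  fromℕ (length (g a) + length (concatMap g as))
    ≡⟨ fromℕ-+ (length (g a)) _ ⟩
  fromℕ (length (g a)) ℚ.+ fromℕ (length (concatMap g as))
    ≡⟨ cong₂ ℚ._+_ eq (fromℕ-length-concatMap f g as eqs) ⟩
  f a ℚ.+ foldr ℚ._+_ ℚ.0ℚ (List.map f as) ∎
  where open ≡-Reasoning

-- A partner of `x` is cut out of `zs`, and injectivity keeps the partners of the other elements in
-- what is left. Since `R` is a relation, one correspondence read in both directions yields both
-- inequalities.
injection⇒length≤ : (R : X → Z → Set) → (∀ {x x′ z} → R x z → R x′ z → x ≡ x′) →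
  {xs : List X} {zs : List Z} → UniqueList xs → (∀ {x} → x ∈ xs → ∃ λ z → z ∈ zs × R x z) →
  length xs ≤ length zs
injection⇒length≤ R inj {[]}     _ _ = z≤n
injection⇒length≤ R inj {x ∷ xs} {zs} (x≢ AllPairs.∷ u) total
  with z , z∈ , r ← total (here refl)
  with ys , ws , refl ← ∈-∃++ z∈ =
  ≤-trans (s≤s (injection⇒length≤ R inj u total′)) (≤-reflexive (sym (List.length-++-sucʳ ys z ws)))
  where
  total′ : ∀ {x′} → x′ ∈ xs → ∃ λ z′ → z′ ∈ ys ++ ws × R x′ z′
  total′ x′∈ with z′ , z′∈ , r′ ← total (there x′∈) with ∈-++⁻ ys z′∈
  ... | inj₁ ∈ys         = z′ , ∈-++⁺ˡ ∈ys , r′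
  ... | inj₂ (there ∈ws) = z′ , ∈-++⁺ʳ ys ∈ws , r′
  ... | inj₂ (here refl) = contradiction (inj r r′) (All.lookup x≢ x′∈)

-- Undoing the reversal

reflect : (X → X) → Vec X n → Vec X n
reflect f w = tabulate λ i → f (lookup w (opposite i))

lookup-reflect : ∀ (f : X → X) (w : Vec X n) i → lookup (reflect f w) i ≡ f (lookup w (opposite i))
lookup-reflect f w = lookup∘tabulate _

reflect-involutive : (f : X → X) → (∀ x → f (f x) ≡ x) → (w : Vec X n) → reflect f (reflect f w) ≡ w
reflect-involutive f ff w = trans (tabulate-cong λ i →
  trans (cong f (lookup-reflect f w (opposite i)))
    (trans (ff _) (cong (lookup w) (Fin.opposite-involutive i)))) (tabulate∘lookup w)

rev : Vec X n → Vec X n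
rev = reflect id

rc : Vec (Fin n) n → Vec (Fin n) n
rc = reflect opposite

rev-involutive : (w : Vec X n) → rev (rev w) ≡ w
rev-involutive = reflect-involutive id λ _ → refl

rc-involutive : (π : Vec (Fin n) n) → rc (rc π) ≡ π
rc-involutive = reflect-involutive opposite Fin.opposite-involutive

opposite-injective : {i j : Fin n} → opposite i ≡ opposite j → i ≡ j
opposite-injective {i = i} {j} eq =
  trans (sym (Fin.opposite-involutive i)) (trans (cong opposite eq) (Fin.opposite-involutive j))

opposite-< : {i j : Fin n} → i Fin.< j → opposite j Fin.< opposite i
opposite-< {i = i} {j} i<j = subst₂ _<_ (sym (Fin.opposite-prop j)) (sym (Fin.opposite-prop i))
  (∸-monoʳ-< (s≤s i<j) (Fin.toℕ<n j))

opposite-<⇔ : {i j : Fin n} → (opposite i Fin.< opposite j) ⇔ (j Fin.< i)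
opposite-<⇔ {i = i} {j} = mk⇔
  (λ lt → subst₂ Fin._<_ (Fin.opposite-involutive j) (Fin.opposite-involutive i) (opposite-< lt)) opposite-<

opposite-adjacent : {i j : Fin n} → toℕ j ≡ suc (toℕ i) → toℕ (opposite i) ≡ suc (toℕ (opposite j))
opposite-adjacent {n} {i} {j} eq = begin
  toℕ (opposite i)       ≡⟨ Fin.opposite-prop i ⟩
  n ∸ suc (toℕ i)        ≡⟨ cong (n ∸_) eq ⟨
  n ∸ toℕ j              ≡⟨ +-∸-assoc 1 (Fin.toℕ<n j) ⟩
  suc (n ∸ suc (toℕ j))  ≡⟨ cong suc (Fin.opposite-prop j) ⟨
  suc (toℕ (opposite j)) ∎
  where open ≡-Reasoning

rc-unique : {π : Vec (Fin n) n} → Unique π → Unique (rc π)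
rc-unique u = Unique.tabulate⁺ λ eq →
  opposite-injective (Unique.lookup-injective u _ _ (opposite-injective eq))

-- Reversing positions and complementing values each turn 321 into 123, so together they preserve
-- it.
rc-has321 : (π : Vec (Fin n) n) → Has321 (rc π) → Has321 π
rc-has321 π (i , j , l , i<j , j<l , ij , jl) =
  opposite l , opposite j , opposite i , opposite-< j<l , opposite-< i<j , descent jl , descent ij
  where
  descent : ∀ {i j} → lookup (rc π) j Fin.< lookup (rc π) i →
            lookup π (opposite i) Fin.< lookup π (opposite j)
  descent {i} {j} lt rewrite lookup-reflect opposite π i | lookup-reflect opposite π j =
    to opposite-<⇔ lt

tabulate-∷ʳ : (f : Fin (suc n) → X) → tabulate f ≡ tabulate (f ∘ inject₁) ∷ʳ f (Fin.fromℕ n)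
tabulate-∷ʳ {zero}  f = refl
tabulate-∷ʳ {suc n} f = cong (f zero ∷_) (tabulate-∷ʳ (f ∘ suc))

opposite-inject₁ : (i : Fin n) → opposite (inject₁ i) ≡ suc (opposite i)
opposite-inject₁ i = opposite-injective (trans (Fin.opposite-involutive (inject₁ i))
  (cong inject₁ (sym (Fin.opposite-involutive i))))

rev-∷ : ∀ (x : X) (w : Vec X n) → rev (x ∷ w) ≡ rev w ∷ʳ x
rev-∷ {n = n} x w = trans (tabulate-∷ʳ {n} (λ i → lookup (x ∷ w) (opposite i)))
  (cong₂ _∷ʳ_ (tabulate-cong λ i → cong (lookup (x ∷ w)) (opposite-inject₁ i))
              (cong (lookup (x ∷ w)) (Fin.opposite-involutive {suc n} zero)))

-- Forward lattice paths and the ballot condition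

data Path : ℕ → Vec Letter n → ℕ → Set where
  []  : Path x [] x
  U∷_ : {w : Vec Letter n} → Path (suc x) w y → Path x (U ∷ w) y
  D∷_ : {w : Vec Letter n} → Path x w y → Path (suc x) (D ∷ w) y

path-∷ʳU⁺ : {w : Vec Letter n} → Path x w y → Path x (w ∷ʳ U) (suc y)
path-∷ʳU⁺ []     = U∷ []
path-∷ʳU⁺ (U∷ h) = U∷ path-∷ʳU⁺ h
path-∷ʳU⁺ (D∷ h) = D∷ path-∷ʳU⁺ h

path-∷ʳU⁻ : {w : Vec Letter n} → Path x (w ∷ʳ U) y → ∃ λ z → y ≡ suc z × Path x w z
path-∷ʳU⁻ {w = []}    (U∷ []) = _ , refl , []
path-∷ʳU⁻ {w = U ∷ w} (U∷ h) with z , e , h′ ← path-∷ʳU⁻ h = z , e , U∷ h′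
path-∷ʳU⁻ {w = D ∷ w} (D∷ h) with z , e , h′ ← path-∷ʳU⁻ h = z , e , D∷ h′

path-∷ʳD⁺ : {w : Vec Letter n} → Path x w (suc y) → Path x (w ∷ʳ D) y
path-∷ʳD⁺ []     = D∷ []
path-∷ʳD⁺ (U∷ h) = U∷ path-∷ʳD⁺ h
path-∷ʳD⁺ (D∷ h) = D∷ path-∷ʳD⁺ h

path-∷ʳD⁻ : {w : Vec Letter n} → Path x (w ∷ʳ D) y → Path x w (suc y)
path-∷ʳD⁻ {w = []}    (D∷ []) = []
path-∷ʳD⁻ {w = U ∷ w} (U∷ h)  = U∷ path-∷ʳD⁻ h
path-∷ʳD⁻ {w = D ∷ w} (D∷ h)  = D∷ path-∷ʳD⁻ h

-- A letter put in front of the backward word is appended to the forward one, which is what the `∷ʳ`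
-- lemmas handle.
height⇒path : {p : Vec Letter n} → Height x p → Path 0 (rev p) x
height⇒path [] = []
height⇒path {p = U ∷ p} (U∷ h) rewrite rev-∷ U p = path-∷ʳU⁺ (height⇒path h)
height⇒path {p = D ∷ p} (D∷ h) rewrite rev-∷ D p = path-∷ʳD⁺ (height⇒path h)

path⇒height : (p : Vec Letter n) → Path 0 (rev p) x → Height x p
path⇒height []      [] = []
path⇒height (U ∷ p) h rewrite rev-∷ U p with z , refl , h′ ← path-∷ʳU⁻ h = U∷ path⇒height p h′
path⇒height (D ∷ p) h rewrite rev-∷ D p = D∷ path⇒height p (path-∷ʳD⁻ h)

-- At `x = 0` this is `Ballot` by computation; the offset carries the height reached by letters
-- already split off.
StaysAbove : ℕ → Vec Letter n → Set
StaysAbove x w = All (λ u → occurrences D u ≤ x + occurrences U u) (List.inits (toList w))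

path⇒above : {w : Vec Letter n} → Path x w y → StaysAbove x w
path⇒above []             = z≤n ∷ []
path⇒above {x = x} (U∷ h) =
  z≤n ∷ All.map⁺ (All.map (λ le → ≤-trans le (≤-reflexive (sym (+-suc x _)))) (path⇒above h))
path⇒above (D∷ h)         = z≤n ∷ All.map⁺ (All.map s≤s (path⇒above h))

above⇒path : (w : Vec Letter n) → StaysAbove x w → ∃ λ y → Path x w y
above⇒path [] _ = _ , []
above⇒path {x = x} (U ∷ w) (_ ∷ all)
  with y , h ← above⇒path w (All.map (λ le → ≤-trans le (≤-reflexive (+-suc x _))) (All.map⁻ all)) = y , U∷ h
-- The one-letter prefix D violates the bound at offset 0.
above⇒path {x = zero}  (D ∷ w) (_ ∷ () ∷ _)
above⇒path {x = suc x} (D ∷ w) (_ ∷ all) with y , h ← above⇒path w (All.map s≤s⁻¹ (All.map⁻ all)) = y , D∷ h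

path-length : {w : Vec Letter n} → Path x w y → x + n ≡ y + 2 * occurrences D (toList w)
path-length []     = refl
path-length (U∷ h) = trans (+-suc _ _) (path-length h)
path-length {n = suc n} {suc x} {y} {D ∷ w} (D∷ h) = begin
  suc x + suc n       ≡⟨ +-suc (suc x) n ⟩
  2 + (x + n)         ≡⟨ cong (2 +_) (path-length h) ⟩
  2 + (y + 2 * o)     ≡⟨ solve 2 (λ y o → con 2 :+ (y :+ con 2 :* o) := y :+ con 2 :* (con 1 :+ o)) refl y o ⟩
  y + 2 * suc o       ∎
  where
  open ≡-Reasoning
  open +-*-Solver
  o = occurrences D (toList w)

-- Ties the common height of the two words to the number of D's in one of them, which is how `a`
-- enters the count.
path-end : {w : Vec Letter n} → Path 0 w y → y ≡ n ∸ 2 * occurrences D (toList w)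
path-end {y = y} {w} h = sym (trans (cong (_∸ 2 * o) (path-length h)) (m+n∸n≡m y (2 * o)))
  where o = occurrences D (toList w)

-- The correspondence between 321-avoiding permutations and pairs of ballot words

-- The permutation and its recording word are turned back to their forward reading, in which `𝒟321`
-- and `KWord` are stated; the other word stays backward, the form in which `ballots` lists it.
record Correspond (π : Vec (Fin n) n) (Qp : Vec Letter n × Vec Letter n) : Set where
  constructor correspond
  field
    rsk : RSK (proj₂ Qp) (rev (proj₁ Qp)) (rc π)

rev-injective : {v w : Vec X n} → rev v ≡ rev w → v ≡ w
rev-injective {v = v} {w} eq = trans (sym (rev-involutive v)) (trans (cong rev eq) (rev-involutive w))

rc-injective : {π π′ : Vec (Fin n) n} → rc π ≡ rc π′ → π ≡ π′
rc-injective {π = π} {π′} eq = trans (sym (rc-involutive π)) (trans (cong rc eq) (rc-involutive π′))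

correspond-functional : ∀ {π π′ : Vec (Fin n) n} {Qp} → Correspond π Qp → Correspond π′ Qp → π ≡ π′
correspond-functional (correspond r) (correspond r′) = rc-injective (rsk-functional r r′)

correspond-injective : ∀ {π : Vec (Fin n) n} {Qp Q′p′} → Correspond π Qp → Correspond π Q′p′ → Qp ≡ Q′p′
correspond-injective (correspond r) (correspond r′) with p≡ , Q≡ ← rsk-injective r r′ refl =
  cong₂ _,_ (rev-injective Q≡) p≡

-- Reversal swaps the two positions and complementation reverses the order of values, so a descent
-- stays a descent, while DU in the backward word reads UD forwards.
correspond-adjacent : ∀ {π : Vec (Fin n) n} {Q p} → Correspond π (Q , p) → ∀ i j → toℕ j ≡ suc (toℕ i) →
  (lookup π i Fin.> lookup π j) ⇔ IsUD (lookup Q i) (lookup Q j)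
correspond-adjacent {π = π} {Q} (correspond r) i j eq
  with rsk-descents r (opposite j) (opposite i) (opposite-adjacent eq)
... | descents
  rewrite lookup-reflect opposite π (opposite i) | lookup-reflect opposite π (opposite j)
        | lookup-reflect id Q (opposite i) | lookup-reflect id Q (opposite j)
        | Fin.opposite-involutive i | Fin.opposite-involutive j = mk⇔
  (λ lt → let d , u = to descents (opposite-< lt) in u , d)
  (λ (u , d) → to opposite-<⇔ (from descents (d , u)))

correspond-descents : ∀ {π : Vec (Fin n) n} {Q p} → Correspond π (Q , p) → Des π ≐ Peaks Q
correspond-descents r =
  (λ (i , j , p≡ , j≡ , lt) → i , j , p≡ , j≡ , to   (correspond-adjacent r i j j≡) lt) ,
  (λ (i , j , p≡ , j≡ , ud) → i , j , p≡ , j≡ , from (correspond-adjacent r i j j≡) ud)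

correspond-unique : ∀ {π : Vec (Fin n) n} {Qp} → Correspond π Qp → Unique π
correspond-unique {π = π} (correspond r) = subst Unique (rc-involutive π) (rc-unique (rsk-unique r))

correspond-avoids : ∀ {π : Vec (Fin n) n} {Qp} → Correspond π Qp → ¬ Has321 π
correspond-avoids {π = π} (correspond r) has = Invariant.avoids (rsk-invariant r)
  (rc-has321 (rc π) (subst Has321 (sym (rc-involutive π)) has))

-- Assembling the count over the number of D's

module _ (k m s : ℕ) .{{_ : NonTrivial k}} (1≤s : 1 ≤ s) (s≤k : s ≤ k) where

  size : ℕ
  size = m * k + s

  private instance
    k≢0 : NonZero k
    k≢0 = nonTrivial⇒nonZero k

  -- Since 1 ≤ s ≤ k, N - 1 = mk + (s-1) has remainder s - 1 modulo k. Thus descents and peaks are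
  -- prescribed at the same multiples of k.
  quotient : (size ∸ 1) / k ≡ m
  quotient = begin
    (m * k + s ∸ 1) / k     ≡⟨ cong (_/ k) (+-∸-assoc (m * k) 1≤s) ⟩
    (m * k + (s ∸ 1)) / k   ≡⟨ +-distrib-/-∣ˡ (s ∸ 1) {k} (divides-refl m) ⟩
    m * k / k + (s ∸ 1) / k ≡⟨ cong₂ _+_ (m*n/n≡m m k) (m<n⇒m/n≡0 s∸1<k) ⟩
    m + 0                   ≡⟨ +-identityʳ m ⟩
    m                       ∎
    where
    open ≡-Reasoning
    s∸1<k : s ∸ 1 < k
    s∸1<k = ≤-trans (≤-reflexive (m+[n∸m]≡n 1≤s)) s≤k

  perms : List (Vec (Fin size) size)
  perms = filter (𝒟321? size k) (words (allFin size) size)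

  kWords : ℕ → List (Vec Letter size)
  kWords a = filter (KWord? k m s a) (words (U ∷ D ∷ []) size)

  pairsAt : ℕ → List (Vec Letter size × Vec Letter size)
  pairsAt a = cartesianProduct (kWords a) (ballots size (size ∸ 2 * a))

  pairs : List (Vec Letter size × Vec Letter size)
  pairs = concatMap pairsAt (upTo (suc ⌊ size /2⌋))

  multiples : Multiples k ((size ∸ 1) / k) ≐ Multiples k m
  multiples rewrite quotient = (λ x → x) , (λ x → x)

  ∈-words : (w : Vec Letter size) → w ∈ words (U ∷ D ∷ []) size
  ∈-words = words-complete λ { U → here refl ; D → there (here refl) }

  ∈-pairsAt⁻ : ∀ {a Q p} → (Q , p) ∈ pairsAt a → KWord k m s a Q × Height (size ∸ 2 * a) p
  ∈-pairsAt⁻ {a} Qp∈ with Q∈ , p∈ ← ∈-cartesianProduct⁻ (kWords a) _ Qp∈ =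
    proj₂ (∈-filter⁻ (KWord? k m s a) {xs = words (U ∷ D ∷ []) size} Q∈) , ∈-ballots⁻ _ p∈

  -- The number of D's in the first component determines `a`.
  pairsAt-disjoint : ∀ {a b} → a ≢ b → Disjoint (pairsAt a) (pairsAt b)
  pairsAt-disjoint {a} {b} a≢b (∈a , ∈b)
    with (_ , refl , _) , _ ← ∈-pairsAt⁻ {a} ∈a | (_ , refl , _) , _ ← ∈-pairsAt⁻ {b} ∈b = a≢b refl

  perms-unique : UniqueList perms
  perms-unique = UniqueList.filter⁺ (𝒟321? size k) (words-unique (UniqueList.allFin⁺ size) size)

  letters-unique : UniqueList (U ∷ D ∷ [])
  letters-unique = ((λ ()) ∷ []) AllPairs.∷ [] AllPairs.∷ AllPairs.[]

  pairs-unique : UniqueList pairs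
  pairs-unique = UniqueList.concat⁺
    (All.map⁺ (All.universal (λ a → UniqueList.cartesianProduct⁺
      (UniqueList.filter⁺ (KWord? k m s a) (words-unique letters-unique size))
      (ballots-unique size (size ∸ 2 * a))) _))
    (AllPairs.map⁺ (AllPairs.map pairsAt-disjoint (UniqueList.upTo⁺ (suc ⌊ size /2⌋))))

  pair-of : ∀ {π} → π ∈ perms → ∃ λ Qp → Qp ∈ pairs × Correspond π Qp
  pair-of {π} π∈
    with (u , des) , av ← proj₂ (∈-filter⁻ (𝒟321? size k) {xs = words (allFin size) size} π∈)
    with p , Q̃ , r ← rsk-surjective (rc π) (rc-unique u) (av ∘ rc-has321 π)
    -- One height `y` serves both words; by `path-end` it is N - 2a, as membership in `pairsAt a`
    -- demands.
    with y , hp , hQ ← rsk-height r =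
      (rev Q̃ , p) , ∈-concatMap⁺ pairsAt (lose (∈-upTo⁺ (s≤s a≤)) (∈-cartesianProduct⁺
        (∈-filter⁺ (KWord? k m s a) (∈-words (rev Q̃)) (path⇒above path , refl , peaks))
        (∈-ballots⁺ (subst (λ y → Height y p) (path-end path) hp)))) , c
    where
    a = occurrences D (toList (rev Q̃))
    c : Correspond π (rev Q̃ , p)
    c = correspond (subst (λ q → RSK p q (rc π)) (sym (rev-involutive Q̃)) r)
    peaks : Peaks (rev Q̃) ≐ Multiples k m
    peaks = ≐-trans (≐-sym (correspond-descents c)) (≐-trans des multiples)
    path : Path 0 (rev Q̃) y
    path = height⇒path hQ
    a≤ : a ≤ ⌊ size /2⌋
    a≤ = ≤-trans (≤-reflexive (trans (n≡⌊n+n/2⌋ a) (cong (λ z → ⌊ a + z /2⌋) (sym (+-identityʳ a)))))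
           (⌊n/2⌋-mono (≤-trans (m≤n+m (2 * a) y) (≤-reflexive (sym (path-length path)))))

  perm-of : ∀ {Qp} → Qp ∈ pairs → ∃ λ π → π ∈ perms × Correspond π Qp
  perm-of {Q , p} Qp∈
    with a , _ , ∈a ← find (∈-concatMap⁻ pairsAt {xs = upTo (suc ⌊ size /2⌋)} Qp∈)
    with (ballot , refl , peaks) , hp ← ∈-pairsAt⁻ {a} ∈a
    with y , path ← above⇒path Q ballot
    with σ , r ← rsk-exists (subst (λ y → Height y p) (sym (path-end path)) hp)
                            (path⇒height (rev Q) (subst (λ q → Path 0 q y) (sym (rev-involutive Q)) path)) =
      rc σ , ∈-filter⁺ (𝒟321? size k) (words-complete ∈-allFin (rc σ))
        ((correspond-unique c , descents) , correspond-avoids c) , c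
    where
    c : Correspond (rc σ) (Q , p)
    c = correspond (subst (RSK p (rev Q)) (sym (rc-involutive σ)) r)
    descents : Des (rc σ) ≐ Multiples k ((size ∸ 1) / k)
    descents = ≐-trans (correspond-descents c) (≐-trans peaks (≐-sym multiples))

  ∣perms∣≡∣pairs∣ : length perms ≡ length pairs
  ∣perms∣≡∣pairs∣ = ≤-antisym
    (injection⇒length≤ Correspond correspond-functional perms-unique pair-of)
    (injection⇒length≤ (λ Qp π → Correspond π Qp) correspond-injective pairs-unique perm-of)

  ∣pairsAt∣ : ∀ {a} → a ∈ upTo (suc ⌊ size /2⌋) →
              fromℕ (length (pairsAt a)) ≡ fromℕ (K k m s a) *ℚ ballotNumber size a
  ∣pairsAt∣ {a} a∈ = begin
    fromℕ (length (pairsAt a))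
      ≡⟨ cong fromℕ (length-cartesianProduct (kWords a) _) ⟩
    fromℕ (K k m s a * ∣ballots∣ size (size ∸ 2 * a))
      ≡⟨ fromℕ-* (K k m s a) _ ⟩
    fromℕ (K k m s a) *ℚ fromℕ (∣ballots∣ size (size ∸ 2 * a))
      ≡⟨ cong (fromℕ (K k m s a) *ℚ_) (ballotNumber≡ size a 2a≤size) ⟨
    fromℕ (K k m s a) *ℚ ballotNumber size a ∎
    where
    open ≡-Reasoning
    a≤ : a ≤ ⌊ size /2⌋
    a≤ = s≤s⁻¹ (∈-upTo⁻ a∈)
    -- This makes the truncated subtractions in `ballotNumber` exact.
    2a≤size : 2 * a ≤ size
    2a≤size = ≤-trans (≤-reflexive (cong (a +_) (+-identityʳ a)))
      (≤-trans (+-mono-≤ a≤ (≤-trans a≤ (⌊n/2⌋≤⌈n/2⌉ size))) (≤-reflexive (⌊n/2⌋+⌈n/2⌉≡n size)))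

theorem3p7 : (k m s : ℕ) → .{{_ : NonTrivial k}} → 1 ≤ s → s ≤ k →
    let N = m * k + s in
    fromℕ (∣𝒟321∣ N k) ≡ sum[0… ⌊ N /2⌋ ] (λ a → fromℕ (K k m s a) *ℚ ballotNumber N a)
theorem3p7 k m s 1≤s s≤k = trans (cong fromℕ (∣perms∣≡∣pairs∣ k m s 1≤s s≤k))
  (fromℕ-length-concatMap _ (pairsAt k m s 1≤s s≤k) _ (All.tabulate (∣pairsAt∣ k m s 1≤s s≤k)))
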